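{- Let $G=(V,E)$ be a graph with maximum degree $\Delta$, let $n=|V|$, and let $k$ be a positive integer. Let $c:V\to[k+1]$ be a legal $(k+1)$-coloring of $G$ such that $|V_{c,k+1}|\le |V_{c,i}|$ holds for every $i\in[k+1]$, and let $c'$ be the partial $k$-coloring such that $c'(v)=c(v)$ for all $v\in V\setminus V_{c,k+1}$ and $c'(v)=\phi$ for all $v\in V_{c,k+1}$. Then $$\hat{\rho}_k(c')\le\frac{n}{k+1}.$$
   Context: Graphs are finite, simple and undirected; an edge $\{u,v\}$ is written $uv$. For a positive integer $n$, $[n]=\{1,\dots,n\}$. A $k$-coloring of $G=(V,E)$ is a mapping $c:V\to[k]$ (it uses at most $k$ colors, so not every color has to be used); it is legal if $c(u)\ne c(v)$ for every edge $uv\in E$. For a color $i$, the color class $i$ is $V_{c,i}=\{v\in V : c(v)=i\}$. Let $\phi$ be a dummy color (not in $[k]$) representing uncolored vertices. A partial $k$-coloring is a function $c:V\to[k]\cup\{\phi\}$ such that, for every edge $uv\in E$, $c(u)\ne c(v)$ holds whenever $c(u),c(v)\in[k]$. The penalty function $\hat{\rho}_k$ on partial $k$-colorings is the number of vertices assigned the dummy color: $\hat{\rho}_k(c)=|\{v\in V : c(v)=\phi\}|$. -}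

module Defs where

open import Data.Fin using (Fin; fromℕ; toℕ; inject₁; lower₁)
open import Data.Fin.Properties using (_≟_; toℕ-fromℕ; toℕ-injective; inject₁-lower₁)
open import Data.Fin.Subset using (Subset; ∣_∣)
open import Data.List using (map; allFin)
open import Data.List.Extrema.Nat using (max)
open import Data.Maybe as Maybe using (Maybe; just; nothing)
import Data.Maybe.Properties as Maybe
open import Data.Nat as ℕ using (ℕ; suc)
open import Data.Product using (∃; _×_; _,_)
open import Data.Vec using (tabulate)
open import Function using (_∘_)
open import Level using (0ℓ)
open import Relation.Binary using (Rel; Decidable; Symmetric; Irreflexive)
open import Relation.Binary.PropositionalEquality
  using (_≡_; _≢_; refl; sym; trans; cong)
open import Relation.Nullary using (yes; no; does; contradiction)
import Relation.Unary as Unary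

private
  variable
    n k : ℕ

record Graph (n : ℕ) : Set₁ where
  field
    Adj    : Rel (Fin n) 0ℓ
    adj?   : Decidable Adj
    symm   : Symmetric Adj
    irrefl : Irreflexive _≡_ Adj

subset : {P : Fin n → Set} → Unary.Decidable P → Subset n
subset P? = tabulate (does ∘ P?)

degree : Graph n → Fin n → ℕ
degree G v = ∣ subset (Graph.adj? G v) ∣

-- The empty graph gets maximum degree 0.
maxDegree : Graph n → ℕ
maxDegree {n} G = max 0 (map (degree G) (allFin n))

-- Colors are 0-based: color i of [k] is the element of Fin k with value i - 1.
-- Hence [k] sits inside [k+1] via inject₁, and color k+1 is fromℕ k.
Coloring : ℕ → ℕ → Set
Coloring n k = Fin n → Fin k

Legal : Graph n → Coloring n k → Set
Legal G c = ∀ {u v} → Graph.Adj G u v → c u ≢ c v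

colorClass : Coloring n k → Fin k → Subset n
colorClass c i = subset (λ v → c v ≟ i)

-- The dummy color φ is nothing.
record PartialColoring (G : Graph n) (k : ℕ) : Set where
  field
    color : Fin n → Maybe (Fin k)
    legal : ∀ {u v i j} → Graph.Adj G u v →
            color u ≡ just i → color v ≡ just j → i ≢ j

open PartialColoring public

penalty : {G : Graph n} → PartialColoring G k → ℕ
penalty c = ∣ subset (λ v → Maybe.≡-dec _≟_ (color c v) nothing) ∣

UncolorsLast : {G : Graph n} → Coloring n (suc k) → PartialColoring G k → Set
UncolorsLast {k = k} c c′ =
  (∀ v → c v ≢ fromℕ k → Maybe.map inject₁ (color c′ v) ≡ just (c v)) ×
  (∀ v → c v ≡ fromℕ k → color c′ v ≡ nothing)

-- A legal coloring does induce such a partial coloring.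
uncolorsLast-exists : (G : Graph n) (c : Coloring n (suc k)) → Legal G c →
                      ∃ λ (c′ : PartialColoring G k) → UncolorsLast c c′
uncolorsLast-exists {n} {k} G c c-legal =
  record { color = col ; legal = col-legal } , keep , drop
  where
  uncolor : Fin (suc k) → Maybe (Fin k)
  uncolor i with k ℕ.≟ toℕ i
  ... | yes _  = nothing
  ... | no k≢i = just (lower₁ i k≢i)

  col : Fin n → Maybe (Fin k)
  col v = uncolor (c v)

  uncolor-just : ∀ i {j} → uncolor i ≡ just j → inject₁ j ≡ i
  uncolor-just i eq with k ℕ.≟ toℕ i
  uncolor-just i ()   | yes _
  uncolor-just i refl | no k≢i = inject₁-lower₁ i k≢i

  col-legal : ∀ {u v i j} → Graph.Adj G u v →
              col u ≡ just i → col v ≡ just j → i ≢ j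
  col-legal {u} {v} uv p q refl =
    c-legal uv (trans (sym (uncolor-just (c u) p)) (uncolor-just (c v) q))

  uncolor-keep : ∀ i → i ≢ fromℕ k → Maybe.map inject₁ (uncolor i) ≡ just i
  uncolor-keep i i≢ with k ℕ.≟ toℕ i
  ... | yes k≡i =
    contradiction (toℕ-injective (trans (sym k≡i) (sym (toℕ-fromℕ k)))) i≢
  ... | no k≢i  = cong just (inject₁-lower₁ i k≢i)

  keep : ∀ v → c v ≢ fromℕ k → Maybe.map inject₁ (col v) ≡ just (c v)
  keep v = uncolor-keep (c v)

  uncolor-drop : ∀ i → i ≡ fromℕ k → uncolor i ≡ nothing
  uncolor-drop i i≡ with k ℕ.≟ toℕ i
  ... | yes _  = refl
  ... | no k≢i = contradiction (sym (trans (cong toℕ i≡) (toℕ-fromℕ k))) k≢i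

  drop : ∀ v → c v ≡ fromℕ k → col v ≡ nothing
  drop v = uncolor-drop (c v)

{-# OPTIONS --safe #-}
module Submission where

open import Defs
import Algebra.Properties.CommutativeMonoid.Sum
open import Data.Bool using (Bool; if_then_else_)
open import Data.Fin using (Fin; zero; suc; fromℕ)
open import Data.Fin.Properties using (_≟_)
open import Data.Fin.Subset using (∣_∣)
open import Data.Integer as ℤ using (+_; +≤+)
import Data.Integer.Properties as ℤ
open import Data.Maybe using (nothing)
import Data.Maybe.Properties as Maybe
open import Data.Nat using (ℕ; zero; suc; NonZero; _≤_; z≤n; _+_; _*_)
open import Data.Nat.Properties
  using (+-0-commutativeMonoid; +-mono-≤; *-comm; *-identityʳ; module ≤-Reasoning)
open import Data.Product using (_,_)
open import Data.Rational as ℚ using (_/_)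
import Data.Rational.Properties as ℚ
open import Data.Rational.Unnormalised using (mkℚᵘ; *≤*)
import Data.Rational.Unnormalised.Properties as ℚᵘ
open import Data.Vec.Functional using (Vector)
open import Data.Vec.Properties using (tabulate-cong)
open import Function using (_∘_; mk⇔)
open import Relation.Binary.PropositionalEquality
  using (_≡_; refl; sym; cong; cong₂; subst₂; module ≡-Reasoning)
open import Relation.Nullary using (does; yes; no)
open import Relation.Nullary.Decidable using (does-⇔)
open import Relation.Unary using (Decidable)

open Algebra.Properties.CommutativeMonoid.Sum +-0-commutativeMonoid
  using (sum; sum-cong-≗; sum-replicate-zero; ∑-distrib-+)

private
  variable
    n k : ℕ

-- The `suc k` color classes partition the vertices, so their sizes add up to `n`
-- (`sum-colorClass`). A class no larger than any other has size at most the average: `suc k` times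
-- its size is bounded by that sum (`*-≤-sum`). The vertices uncolored by `c′` are exactly the last
-- class (`penalty-uncolorsLast`), so the penalty satisfies this bound, and `/-mono-≤` turns the
-- product inequality into one between rationals.

indicator : Bool → ℕ
indicator b = if b then 1 else 0

∣subset∣-suc : {P : Fin (suc n) → Set} (P? : Decidable P) →
               ∣ subset P? ∣ ≡ indicator (does (P? zero)) + ∣ subset (P? ∘ suc) ∣
∣subset∣-suc P? with P? zero
... | yes _ = refl
... | no  _ = refl

∣subset∣-cong : {P Q : Fin n → Set} (P? : Decidable P) (Q? : Decidable Q) →
                (∀ v → P v → Q v) → (∀ v → Q v → P v) →
                ∣ subset P? ∣ ≡ ∣ subset Q? ∣
∣subset∣-cong P? Q? P⊆Q Q⊆P =
  cong ∣_∣ (tabulate-cong (λ v → does-⇔ (mk⇔ (P⊆Q v) (Q⊆P v)) (P? v) (Q? v)))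

sum-indicator-≟ : (j : Fin k) → sum (λ i → indicator (does (j ≟ i))) ≡ 1
sum-indicator-≟ {suc k} zero    = cong suc (sum-replicate-zero k)
-- The term at `zero` computes to 0, and `does (suc j ≟ suc i)` reduces to `does (j ≟ i)`, so the
-- induction hypothesis applies as it stands.
sum-indicator-≟ {suc k} (suc j) = sum-indicator-≟ j

-- Induction on the number of vertices: vertex `zero` contributes 1 to the class of its own color
-- and 0 to every other, hence 1 to the total.
sum-colorClass : (c : Coloring n k) → sum (λ i → ∣ colorClass c i ∣) ≡ n
sum-colorClass {zero}  {k} c = sum-replicate-zero k
sum-colorClass {suc n} {k} c = begin
  sum (λ i → ∣ colorClass c i ∣)
    ≡⟨ sum-cong-≗ (λ i → ∣subset∣-suc (λ v → c v ≟ i)) ⟩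
  sum (λ i → indicator (does (c zero ≟ i)) + ∣ colorClass (c ∘ suc) i ∣)
    ≡⟨ ∑-distrib-+ (λ i → indicator (does (c zero ≟ i))) (λ i → ∣ colorClass (c ∘ suc) i ∣) ⟩
  sum (λ i → indicator (does (c zero ≟ i))) + sum (λ i → ∣ colorClass (c ∘ suc) i ∣)
    ≡⟨ cong₂ _+_ (sum-indicator-≟ (c zero)) (sum-colorClass (c ∘ suc)) ⟩
  suc n ∎
  where open ≡-Reasoning

*-≤-sum : ∀ {m} (t : Vector ℕ k) → (∀ i → m ≤ t i) → k * m ≤ sum t
*-≤-sum {zero}  t m≤t = z≤n
*-≤-sum {suc k} t m≤t = +-mono-≤ (m≤t zero) (*-≤-sum (t ∘ suc) (m≤t ∘ suc))

penalty-uncolorsLast : {G : Graph n} (c : Coloring n (suc k)) (c′ : PartialColoring G k) →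
                       UncolorsLast c c′ → penalty c′ ≡ ∣ colorClass c (fromℕ k) ∣
penalty-uncolorsLast {n} {k} c c′ (keep , drop) =
  ∣subset∣-cong (λ v → Maybe.≡-dec _≟_ (color c′ v) nothing) (λ v → c v ≟ fromℕ k)
    uncolored⇒last drop
  where
  uncolored⇒last : ∀ v → color c′ v ≡ nothing → c v ≡ fromℕ k
  uncolored⇒last v eq with c v ≟ fromℕ k
  ... | yes last = last
  ... | no ¬last with color c′ v | keep v ¬last
  -- If `color c′ v` were `nothing`, `keep` would equate `nothing` with `just (c v)`.
  uncolored⇒last v refl | no _ | nothing | ()

-- Since `_/_` reduces to lowest terms, the comparison is moved to unnormalised rationals, where the
-- order is cross-multiplication by definition. `mkℚᵘ` stores the denominator minus one, so the
-- arguments `0` and `k` stand for the denominators 1 and `suc k`.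
/-mono-≤ : ∀ {m} → suc k * m ≤ n → (+ m / 1) ℚ.≤ (+ n / suc k)
/-mono-≤ {k} {n} {m} km≤n = ℚ.toℚᵘ-cancel-≤ (begin
  ℚ.toℚᵘ (+ m / 1)      ≃⟨ ℚ.toℚᵘ-fromℚᵘ (mkℚᵘ (+ m) 0) ⟩
  mkℚᵘ (+ m) 0          ≤⟨ *≤* (subst₂ ℤ._≤_ (ℤ.pos-* m (suc k)) (ℤ.pos-* n 1) (+≤+ m*k≤n*1)) ⟩
  mkℚᵘ (+ n) k          ≃⟨ ℚ.toℚᵘ-fromℚᵘ (mkℚᵘ (+ n) k) ⟨
  ℚ.toℚᵘ (+ n / suc k)  ∎)
  where
  open ℚᵘ.≤-Reasoning
  m*k≤n*1 : m * suc k ≤ n * 1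
  m*k≤n*1 = subst₂ _≤_ (*-comm (suc k) m) (sym (*-identityʳ n)) km≤n

proposition4 : (n : ℕ) (G : Graph n) (Δ : ℕ) → maxDegree G ≡ Δ →
    (k : ℕ) → .{{_ : NonZero k}} →
    (c : Coloring n (suc k)) → Legal G c →
    (∀ i → ∣ colorClass c (fromℕ k) ∣ ≤ ∣ colorClass c i ∣) →
    (c′ : PartialColoring G k) → UncolorsLast c c′ →
    (+ penalty c′ / 1) ℚ.≤ (+ n / suc k)
proposition4 n G Δ _ k c _ last-min c′ unc = /-mono-≤ {k} (begin
  suc k * penalty c′                   ≡⟨ cong (suc k *_) (penalty-uncolorsLast c c′ unc) ⟩
  suc k * ∣ colorClass c (fromℕ k) ∣   ≤⟨ *-≤-sum _ last-min ⟩
  sum (λ i → ∣ colorClass c i ∣)       ≡⟨ sum-colorClass c ⟩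
  n                                    ∎)
  where open ≤-Reasoning
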